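{- Let $G$ be a claw-free graph (i.e., $G$ contains no induced subgraph isomorphic to $K_{1,3}$). Then $\alpha_{\mathrm{od}}(G)=\alpha(G^2)$ and $\chi_{\mathrm{so}}(G)=\chi(G^2)$.
   Context: All graphs are finite, simple and undirected. For a vertex $v$, $N(v)$ is its open neighborhood. An odd independent set in a graph $G=(V,E)$ is an independent set $S\subseteq V$ such that for every $v\in V\setminus S$, either $N(v)\cap S=\varnothing$ or $|N(v)\cap S|$ is odd. $\alpha_{\mathrm{od}}(G)$ denotes the maximum size of an odd independent set of $G$. A strong odd coloring of $G$ is a proper vertex coloring such that for every vertex $v$, each color used on $N(v)$ appears an odd number of times in $N(v)$; $\chi_{\mathrm{so}}(G)$ is the minimum number of colors in a strong odd coloring. $G^2$ is the square of $G$: same vertex set, two distinct vertices adjacent iff their distance in $G$ is at most $2$. $\alpha$ and $\chi$ denote independence number and chromatic number. -}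

module Defs where

open import Data.Fin.Base using (Fin; zero; suc)
open import Data.Fin.Properties using (_≟_; any?; all?)
open import Data.Fin.Subset using (Subset; ⊥; ⁅_⁆; _∈_; _∉_; _∩_; ∣_∣; Empty)
open import Data.Fin.Subset.Properties using (_∈?_; nonempty?; anySubset?; ∉⊥; ∣⁅x⁆∣≡1; x∈⁅x⁆; x∈⁅y⁆⇒x≡y; x∈p∩q⁺; x∈p∩q⁻; ⊆-antisym; ∣p∣≤n)
open import Data.Nat.Base using (ℕ; zero; suc; _≤_; z≤n; s≤s; s≤s⁻¹; _%_)
open import Data.Nat.Properties using (≤-refl; ≤-trans; ≤∧≢⇒<; <⇒≱; ≮⇒≥; anyUpTo?; n≤0⇒n≡0) renaming (_≟_ to _≟ℕ_)
open import Data.Product.Base using (∃; ∃-syntax; _×_; _,_; proj₁; proj₂)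
open import Data.Sum.Base using (_⊎_; inj₁)
open import Data.Vec.Base using (Vec; []; _∷_; lookup; tabulate; allFin)
open import Data.Vec.Properties using ([]=⇒lookup; lookup⇒[]=; lookup∘tabulate; lookup-allFin)
open import Function.Bundles using (_⇔_)
open import Function.Definitions using (Injective)
open import Level using (0ℓ)
open import Relation.Binary.Core using (Rel)
open import Relation.Binary.Definitions using (Symmetric; Irreflexive) renaming (Decidable to Decidable₂)
open import Relation.Binary.PropositionalEquality using (_≡_; _≢_; refl; sym; trans; cong; subst; ≢-sym)
open import Relation.Nullary using (¬_; Dec; yes; no; does; contradiction; ¬?; _×-dec_; _⊎-dec_; _→-dec_)
open import Relation.Nullary.Decidable using (map′; dec-true)
open import Relation.Unary using (Pred; Decidable)

private
  variable
    m n k : ℕ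

IsLeast : Pred ℕ 0ℓ → Pred ℕ 0ℓ
IsLeast Q k = Q k × (∀ j → Q j → k ≤ j)

IsGreatest : Pred ℕ 0ℓ → Pred ℕ 0ℓ
IsGreatest Q k = Q k × (∀ j → Q j → j ≤ k)

isLeast? : {Q : Pred ℕ 0ℓ} → Decidable Q → Decidable (IsLeast Q)
isLeast? Q? k = Q? k ×-dec
  map′ (λ ¬below j qj → ≮⇒≥ λ j<k → ¬below (j , j<k , qj))
       (λ { lower (j , j<k , qj) → <⇒≱ j<k (lower j qj) })
       (¬? (anyUpTo? Q? k))

least : {Q : Pred ℕ 0ℓ} → Decidable Q → Q n → ∃ (IsLeast Q)
least {n} {Q} Q? q = search n n q ≤-refl
  where
  search : ∀ fuel b → Q b → b ≤ fuel → ∃ (IsLeast Q)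
  search zero zero qb _ = 0 , qb , λ _ _ → z≤n
  search (suc f) b qb b≤ with anyUpTo? Q? b
  ... | yes (j , j<b , qj) = search f j qj (s≤s⁻¹ (≤-trans j<b b≤))
  ... | no ¬below = b , qb , λ j qj → ≮⇒≥ λ j<b → ¬below (j , j<b , qj)

greatest : {Q : Pred ℕ 0ℓ} → Decidable Q → ∃ Q → (∀ j → Q j → j ≤ n) → ∃ (IsGreatest Q)
greatest {n} {Q} Q? (i , qi) = search n
  where
  search : ∀ b → (∀ j → Q j → j ≤ b) → ∃ (IsGreatest Q)
  search zero upper = 0 , subst Q (n≤0⇒n≡0 (upper i qi)) qi , upper
  search (suc b) upper with Q? (suc b)
  ... | yes q = suc b , q , upper
  ... | no ¬q = search b λ j qj →
    s≤s⁻¹ (≤∧≢⇒< (upper j qj) λ { refl → ¬q qj })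

Odd : Pred ℕ 0ℓ
Odd k = k % 2 ≡ 1

record Graph (n : ℕ) : Set₁ where
  field
    _~_      : Rel (Fin n) 0ℓ
    _~?_     : Decidable₂ _~_
    ~-sym    : Symmetric _~_
    ~-irrefl : Irreflexive _≡_ _~_

  N : Fin n → Subset n
  N v = tabulate λ u → does (v ~? u)

  data Walk : ℕ → Fin n → Fin n → Set where
    []  : ∀ {u} → Walk 0 u u
    _∷_ : ∀ {l u w v} → u ~ w → Walk l w v → Walk (suc l) u v

  -- Two vertices in different components have no distance.
  IsDistance : Fin n → Fin n → ℕ → Set
  IsDistance u v = IsLeast (λ l → Walk l u v)

  walk? : ∀ l u v → Dec (Walk l u v)
  walk? zero u v = map′ (λ { refl → [] }) (λ { [] → refl }) (u ≟ v)
  walk? (suc l) u v =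
    map′ (λ { (_ , e , p) → e ∷ p }) (λ { (e ∷ p) → _ , e , p })
         (any? λ w → (u ~? w) ×-dec walk? l w v)

  walk-snoc : ∀ {l u w v} → Walk l u w → w ~ v → Walk (suc l) u v
  walk-snoc []      e = e ∷ []
  walk-snoc (f ∷ p) e = f ∷ walk-snoc p e

  walk-reverse : ∀ {l u v} → Walk l u v → Walk l v u
  walk-reverse []      = []
  walk-reverse (e ∷ p) = walk-snoc (walk-reverse p) (~-sym e)

open Graph public using (N)

_² : Graph n → Graph n
_² {n} G = record
  { _~_      = _~²_
  ; _~?_     = λ u v → ¬? (u ≟ v) ×-dec
      map′ (λ { (d , d<3 , isd) → d , s≤s⁻¹ d<3 , isd })
           (λ { (d , d≤2 , isd) → d , s≤s d≤2 , isd })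
           (anyUpTo? (isLeast? (λ l → walk? l u v)) 3)
  ; ~-sym    = λ { (u≢v , d , d≤2 , p , lower) →
      ≢-sym u≢v , d , d≤2 , walk-reverse p , λ j q → lower j (walk-reverse q) }
  ; ~-irrefl = λ { u≡v (u≢v , _) → u≢v u≡v }
  }
  where
  open Graph G
  _~²_ : Rel (Fin n) 0ℓ
  u ~² v = u ≢ v × ∃[ d ] d ≤ 2 × IsDistance u v d

-- An injection preserving and reflecting adjacency is an isomorphism from H
-- onto the subgraph of G induced by its image.
HasInduced : Graph m → Graph n → Set
HasInduced {m} {n} H G = ∃[ f ] Injective _≡_ _≡_ f × (∀ a b → (a H.~ b) ⇔ (f a G.~ f b))
  where
  module H = Graph H
  module G = Graph G

data StarAdj (m : ℕ) : Rel (Fin (suc m)) 0ℓ where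
  centre-leaf : ∀ i → StarAdj m zero (suc i)
  leaf-centre : ∀ i → StarAdj m (suc i) zero

K₁, : ∀ m → Graph (suc m)
K₁, m = record
  { _~_      = StarAdj m
  ; _~?_     = λ { zero    zero    → no λ ()
                 ; zero    (suc i) → yes (centre-leaf i)
                 ; (suc i) zero    → yes (leaf-centre i)
                 ; (suc i) (suc j) → no λ () }
  ; ~-sym    = λ { (centre-leaf i) → leaf-centre i ; (leaf-centre i) → centre-leaf i }
  ; ~-irrefl = λ { refl () }
  }

ClawFree : Graph n → Set
ClawFree G = ¬ HasInduced (K₁, 3) G

Independent : Graph n → Pred (Subset n) 0ℓ
Independent G S = ∀ u v → u ∈ S → v ∈ S → ¬ (u ~ v)
  where open Graph G

OddIndependent : Graph n → Pred (Subset n) 0ℓ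
OddIndependent G S =
  Independent G S × (∀ v → v ∉ S → Empty (N G v ∩ S) ⊎ Odd ∣ N G v ∩ S ∣)

independent? : (G : Graph n) → Decidable (Independent G)
independent? G S = all? λ u → all? λ v →
  (u ∈? S) →-dec ((v ∈? S) →-dec ¬? (u ~? v))
  where open Graph G

oddIndependent? : (G : Graph n) → Decidable (OddIndependent G)
oddIndependent? G S = independent? G S ×-dec
  all? λ v → ¬? (v ∈? S) →-dec
    (¬? (nonempty? (N G v ∩ S)) ⊎-dec (∣ N G v ∩ S ∣ % 2 ≟ℕ 1))

independent-⊥ : (G : Graph n) → Independent G ⊥
independent-⊥ G u v u∈⊥ = contradiction u∈⊥ ∉⊥

oddIndependent-⊥ : (G : Graph n) → OddIndependent G ⊥
oddIndependent-⊥ G = independent-⊥ G , λ v _ →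
  inj₁ λ { (u , u∈) → ∉⊥ (proj₂ (x∈p∩q⁻ (N G v) ⊥ u∈)) }

SizeOf : Pred (Subset n) 0ℓ → Pred ℕ 0ℓ
SizeOf P k = ∃[ S ] P S × ∣ S ∣ ≡ k

maxSize : {P : Pred (Subset n) 0ℓ} → Decidable P → P ⊥ → ∃ (IsGreatest (SizeOf P))
maxSize {n} P? P⊥ = greatest
  (λ k → anySubset? λ S → P? S ×-dec (∣ S ∣ ≟ℕ k))
  (∣ ⊥ {n} ∣ , ⊥ , P⊥ , refl)
  (λ { _ (S , _ , refl) → ∣p∣≤n S })

α : Graph n → ℕ
α G = proj₁ (maxSize (independent? G) (independent-⊥ G))

αod : Graph n → ℕ
αod G = proj₁ (maxSize (oddIndependent? G) (oddIndependent-⊥ G))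

α-isGreatest : (G : Graph n) → IsGreatest (SizeOf (Independent G)) (α G)
α-isGreatest G = proj₂ (maxSize (independent? G) (independent-⊥ G))

αod-isGreatest : (G : Graph n) → IsGreatest (SizeOf (OddIndependent G)) (αod G)
αod-isGreatest G = proj₂ (maxSize (oddIndependent? G) (oddIndependent-⊥ G))

Coloring : ℕ → ℕ → Set
Coloring n k = Vec (Fin k) n

class : Coloring n k → Fin k → Subset n
class c i = tabulate λ u → does (lookup c u ≟ i)

Proper : Graph n → Coloring n k → Set
Proper G c = ∀ u v → u ~ v → lookup c u ≢ lookup c v
  where open Graph G

StrongOdd : Graph n → Coloring n k → Set
StrongOdd G c = Proper G c ×
  (∀ v i → (∃[ u ] u ∈ N G v × lookup c u ≡ i) → Odd ∣ N G v ∩ class c i ∣)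

Colorable : Graph n → Pred ℕ 0ℓ
Colorable {n} G k = ∃[ c ] Proper {n} {k} G c

StrongOddColorable : Graph n → Pred ℕ 0ℓ
StrongOddColorable {n} G k = ∃[ c ] StrongOdd {n} {k} G c

proper? : (G : Graph n) → Decidable (Proper {n} {k} G)
proper? G c = all? λ u → all? λ v → (u ~? v) →-dec ¬? (lookup c u ≟ lookup c v)
  where open Graph G

strongOdd? : (G : Graph n) → Decidable (StrongOdd {n} {k} G)
strongOdd? G c = proper? G c ×-dec all? λ v → all? λ i →
  any? (λ u → (u ∈? N G v) ×-dec (lookup c u ≟ i)) →-dec
  (∣ N G v ∩ class c i ∣ % 2 ≟ℕ 1)

anyColoring? : {P : Pred (Coloring n k) 0ℓ} → Decidable P → Dec (∃ P)
anyColoring? {zero} P? = map′ (λ p → [] , p) (λ { ([] , p) → p }) (P? [])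
anyColoring? {suc n} P? =
  map′ (λ { (i , c , p) → i ∷ c , p }) (λ { (i ∷ c , p) → i , c , p })
       (any? λ i → anyColoring? λ c → P? (i ∷ c))

class-allFin⁺ : (i : Fin n) → i ∈ class (allFin n) i
class-allFin⁺ {n} i = lookup⇒[]= i (class (allFin n) i)
  (trans (lookup∘tabulate _ i) (dec-true (lookup (allFin n) i ≟ i) (lookup-allFin i)))

class-allFin⁻ : {u i : Fin n} → u ∈ class (allFin n) i → u ≡ i
class-allFin⁻ {n} {u} {i} u∈ with lookup (allFin n) u ≟ i
  | trans (sym (lookup∘tabulate (λ w → does (lookup (allFin n) w ≟ i)) u)) ([]=⇒lookup u∈)
... | yes eq | _ = trans (sym (lookup-allFin u)) eq
... | no _   | ()

proper-allFin : (G : Graph n) → Proper G (allFin n)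
proper-allFin G u v u~v eq =
  Graph.~-irrefl G (trans (sym (lookup-allFin u)) (trans eq (lookup-allFin v))) u~v

strongOdd-allFin : (G : Graph n) → StrongOdd G (allFin n)
strongOdd-allFin {n} G = proper-allFin G , odd
  where
  odd : ∀ v i → (∃[ u ] u ∈ N G v × lookup (allFin n) u ≡ i) →
        Odd ∣ N G v ∩ class (allFin n) i ∣
  odd v i (u , u∈N , eq) = cong (_% 2) (trans (cong ∣_∣ ∩≡⁅i⁆) (∣⁅x⁆∣≡1 i))
    where
    i∈N : i ∈ N G v
    i∈N = subst (_∈ N G v) (trans (sym (lookup-allFin u)) eq) u∈N
    ∩≡⁅i⁆ : N G v ∩ class (allFin n) i ≡ ⁅ i ⁆
    ∩≡⁅i⁆ = ⊆-antisym
      (λ w∈ → subst (_∈ ⁅ i ⁆) (sym (class-allFin⁻ (proj₂ (x∈p∩q⁻ (N G v) _ w∈)))) (x∈⁅x⁆ i))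
      (λ w∈ → subst (_∈ N G v ∩ class (allFin n) i) (sym (x∈⁅y⁆⇒x≡y i w∈))
                (x∈p∩q⁺ (i∈N , class-allFin⁺ i)))

minColors : (G : Graph n) → ∃ (IsLeast (Colorable G))
minColors {n} G = least (λ k → anyColoring? (proper? G)) (allFin n , proper-allFin G)

minStrongOddColors : (G : Graph n) → ∃ (IsLeast (StrongOddColorable G))
minStrongOddColors {n} G =
  least (λ k → anyColoring? (strongOdd? G)) (allFin n , strongOdd-allFin G)

χ : Graph n → ℕ
χ G = proj₁ (minColors G)

χso : Graph n → ℕ
χso G = proj₁ (minStrongOddColors G)

χ-isLeast : (G : Graph n) → IsLeast (Colorable G) (χ G)
χ-isLeast G = proj₂ (minColors G)

χso-isLeast : (G : Graph n) → IsLeast (StrongOddColorable G) (χso G)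
χso-isLeast G = proj₂ (minStrongOddColors G)

{-# OPTIONS --safe #-}
-- In a claw-free graph an independent set S meets the neighbourhood of a vertex
-- in at most two vertices, so an odd intersection has exactly one element.
-- Hence S is odd independent iff no two of its vertices are within distance 2,
-- and a colouring is strong odd iff all its classes are odd independent.
module Submission where

open import Defs
open import Data.Fin.Base using (Fin; zero; suc)
open import Data.Fin.Properties using (_≟_; any?)
open import Data.Fin.Subset using (Subset; ⁅_⁆; _∈_; _∉_; _∩_; _∪_; ∣_∣)
open import Data.Fin.Subset.Properties using (_∈?_; nonempty?; ∣⁅x⁆∣≡1; x∈⁅x⁆; x∈⁅y⁆⇒x≡y; x∈p∩q⁺; x∈p∩q⁻; x∈p∪q⁺; x∈p∪q⁻; ⊆-antisym; ∪-identityˡ; ∪-identityʳ)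
open import Data.Nat.Base using (ℕ; suc; _≤_; z≤n; s≤s; _%_)
open import Data.Nat.Properties using (≤-antisym; ≤-trans; ≤-refl)
open import Data.Product.Base using (∃-syntax; _×_; _,_; proj₁; proj₂)
open import Data.Sum.Base using (inj₁; inj₂; [_,_]′)
open import Data.Vec.Base using (Vec; []; _∷_; lookup; tabulate)
open import Data.Vec.Properties using ([]=⇒lookup; lookup⇒[]=; lookup∘tabulate)
open import Data.Vec.Relation.Unary.All using (All; []; _∷_)
open import Data.Vec.Relation.Unary.All.Properties using (lookup⁺)
open import Data.Vec.Relation.Unary.AllPairs using ([]; _∷_)
open import Data.Vec.Relation.Unary.Unique.Propositional using (Unique)
open import Data.Vec.Relation.Unary.Unique.Propositional.Properties using (lookup-injective)
open import Function.Base using (_∘_; id)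
open import Function.Bundles using (_⇔_; mk⇔; module Equivalence)
open import Function.Definitions using (Injective)
open import Level using (0ℓ)
open import Relation.Binary.PropositionalEquality using (_≡_; _≢_; refl; sym; trans; cong; subst)
open import Relation.Nullary using (¬_; yes; no; does; contradiction; ¬?; _×-dec_)
open import Relation.Nullary.Decidable using (dec-true; decidable-stable)
open import Relation.Unary using (Pred; Decidable)

open Equivalence using (to; from)

private
  variable
    m n k l : ℕ

-- Pointwise equivalent predicates admit the same values, so each extremum bounds the other. This
-- lets the theorem treat `α`, `αod`, `χ` and `χso` through their extremal properties alone, without
-- unfolding the searches that compute them.
IsGreatest-unique : {P Q : Pred ℕ 0ℓ} → (∀ i → P i ⇔ Q i) → IsGreatest P k → IsGreatest Q l → k ≡ l
IsGreatest-unique P⇔Q (Pk , ≤k) (Ql , ≤l) =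
  ≤-antisym (≤l _ (to (P⇔Q _) Pk)) (≤k _ (from (P⇔Q _) Ql))

IsLeast-unique : {P Q : Pred ℕ 0ℓ} → (∀ i → P i ⇔ Q i) → IsLeast P k → IsLeast Q l → k ≡ l
IsLeast-unique P⇔Q (Pk , k≤) (Ql , l≤) =
  ≤-antisym (k≤ _ (from (P⇔Q _) Ql)) (l≤ _ (to (P⇔Q _) Pk))

∈-tabulate⁺ : {P : Pred (Fin n) 0ℓ} (P? : Decidable P) {x : Fin n} → P x → x ∈ tabulate (does ∘ P?)
∈-tabulate⁺ P? {x} Px =
  lookup⇒[]= x _ (trans (lookup∘tabulate _ x) (dec-true (P? x) Px))

∈-tabulate⁻ : {P : Pred (Fin n) 0ℓ} (P? : Decidable P) {x : Fin n} → x ∈ tabulate (does ∘ P?) → P x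
∈-tabulate⁻ P? {x} x∈ with P? x | trans (sym (lookup∘tabulate (does ∘ P?) x)) ([]=⇒lookup x∈)
... | yes Px | _ = Px
... | no _   | ()

∣⁅x⁆∪⁅y⁆∣≡2 : {x y : Fin n} → x ≢ y → ∣ ⁅ x ⁆ ∪ ⁅ y ⁆ ∣ ≡ 2
∣⁅x⁆∪⁅y⁆∣≡2 {x = zero}  {zero}  x≢y = contradiction refl x≢y
∣⁅x⁆∪⁅y⁆∣≡2 {x = zero}  {suc y} x≢y = cong suc (trans (cong ∣_∣ (∪-identityˡ ⁅ y ⁆)) (∣⁅x⁆∣≡1 y))
∣⁅x⁆∪⁅y⁆∣≡2 {x = suc x} {zero}  x≢y = cong suc (trans (cong ∣_∣ (∪-identityʳ ⁅ x ⁆)) (∣⁅x⁆∣≡1 x))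
∣⁅x⁆∪⁅y⁆∣≡2 {x = suc x} {suc y} x≢y = ∣⁅x⁆∪⁅y⁆∣≡2 (x≢y ∘ cong suc)

-- Without a third element `p` would be exactly the pair `x`, `y`, whose size 2 is even. This is how
-- a parity condition produces the third leaf of a claw.
odd-third : {p : Subset n} {x y : Fin n} → Odd ∣ p ∣ → x ∈ p → y ∈ p → x ≢ y →
            ∃[ z ] z ∈ p × x ≢ z × y ≢ z
odd-third {p = p} {x} {y} odd x∈p y∈p x≢y
  with any? (λ z → (z ∈? p) ×-dec (¬? (x ≟ z) ×-dec ¬? (y ≟ z)))
... | yes found = found
... | no none = contradiction
  (trans (sym (cong (_% 2) (trans (cong ∣_∣ p≡) (∣⁅x⁆∪⁅y⁆∣≡2 x≢y)))) odd) λ ()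
  where
  p⊆ : ∀ {z} → z ∈ p → z ∈ ⁅ x ⁆ ∪ ⁅ y ⁆
  p⊆ {z} z∈p with x ≟ z | y ≟ z
  ... | yes refl | _        = x∈p∪q⁺ (inj₁ (x∈⁅x⁆ x))
  ... | no _     | yes refl = x∈p∪q⁺ (inj₂ (x∈⁅x⁆ y))
  ... | no x≢z   | no y≢z   = contradiction (z , z∈p , x≢z , y≢z) none
  p≡ : p ≡ ⁅ x ⁆ ∪ ⁅ y ⁆
  p≡ = ⊆-antisym p⊆ λ z∈ →
    [ (λ z∈x → subst (_∈ p) (sym (x∈⁅y⁆⇒x≡y x z∈x)) x∈p)
    , (λ z∈y → subst (_∈ p) (sym (x∈⁅y⁆⇒x≡y y z∈y)) y∈p) ]′ (x∈p∪q⁻ ⁅ x ⁆ ⁅ y ⁆ z∈)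

odd-singleton : {p : Subset n} {x : Fin n} → x ∈ p → (∀ {y} → y ∈ p → y ≡ x) → Odd ∣ p ∣
odd-singleton {p = p} {x} x∈p only = cong (_% 2) (trans (cong ∣_∣ p≡⁅x⁆) (∣⁅x⁆∣≡1 x))
  where
  p≡⁅x⁆ : p ≡ ⁅ x ⁆
  p≡⁅x⁆ = ⊆-antisym
    (λ y∈p → subst (_∈ ⁅ x ⁆) (sym (only y∈p)) (x∈⁅x⁆ x))
    (λ y∈x → subst (_∈ p) (sym (x∈⁅y⁆⇒x≡y x y∈x)) x∈p)

module _ (G : Graph n) where
  open Graph G using (_~_; _~?_; ~-sym; ~-irrefl; Walk; []; _∷_; walk?)
  open Graph (G ²) using () renaming (_~_ to _~²_)

  ∈N⁺ : ∀ {u v} → v ~ u → u ∈ N G v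
  ∈N⁺ {v = v} = ∈-tabulate⁺ (v ~?_)

  ∈N⁻ : ∀ {u v} → u ∈ N G v → v ~ u
  ∈N⁻ {v = v} = ∈-tabulate⁻ (v ~?_)

  -- A walk need not be shortest, but its length bounds the distance that `least` extracts. Later
  -- proofs can therefore exhibit any walk of length at most 2.
  walk⇒~² : ∀ {u v} → u ≢ v → Walk l u v → l ≤ 2 → u ~² v
  walk⇒~² {u = u} {v} u≢v p l≤2 =
    let d , isd = least (λ l → walk? l u v) p
    in u≢v , d , ≤-trans (proj₂ isd _ p) l≤2 , isd

  inducedStar : ∀ {v} {leaf : Fin m → Fin n} → Injective _≡_ _≡_ leaf →
                (∀ i → v ~ leaf i) → (∀ i j → ¬ leaf i ~ leaf j) → HasInduced (K₁, m) G
  inducedStar {m} {v} {leaf} leaf-inj v~leaf leaf≁leaf = f , f-inj , adj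
    where
    f : Fin (suc m) → Fin n
    f zero    = v
    f (suc i) = leaf i
    f-inj : Injective _≡_ _≡_ f
    f-inj {zero}  {zero}  _  = refl
    -- The centre differs from every leaf because it is adjacent to it and adjacency is irreflexive.
    f-inj {zero}  {suc j} eq = contradiction (v~leaf j) (~-irrefl eq)
    f-inj {suc i} {zero}  eq = contradiction (v~leaf i) (~-irrefl (sym eq))
    f-inj {suc i} {suc j} eq = cong suc (leaf-inj eq)
    adj : ∀ a b → StarAdj m a b ⇔ (f a ~ f b)
    adj zero    zero    = mk⇔ (λ ()) (λ v~v → contradiction v~v (~-irrefl refl))
    adj zero    (suc j) = mk⇔ (λ _ → v~leaf j) (λ _ → centre-leaf j)
    adj (suc i) zero    = mk⇔ (λ _ → ~-sym (v~leaf i)) (λ _ → leaf-centre i)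
    adj (suc i) (suc j) = mk⇔ (λ ()) (λ i~j → contradiction i~j (leaf≁leaf i j))

  inducedStar-independent : ∀ {S v} {xs : Vec (Fin n) m} → Independent G S →
                            Unique xs → All (_∈ N G v ∩ S) xs → HasInduced (K₁, m) G
  inducedStar-independent {S = S} {v} {xs} indep unique all = inducedStar
    (lookup-injective unique _ _)
    (λ i → ∈N⁻ (proj₁ (mem i)))
    (λ i j → indep _ _ (proj₂ (mem i)) (proj₂ (mem j)))
    where
    mem : ∀ i → lookup xs i ∈ N G v × lookup xs i ∈ S
    mem i = x∈p∩q⁻ (N G v) S (lookup⁺ all i)

  -- Two distinct members would force a third by parity, and three independent neighbours of `v`
  -- form a claw centred at `v`. Claw-freeness enters the argument here.
  odd-neighbours-unique : ClawFree G → ∀ {S u v w} → Independent G S → Odd ∣ N G v ∩ S ∣ →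
                          u ∈ N G v ∩ S → w ∈ N G v ∩ S → u ≡ w
  odd-neighbours-unique clawFree {u = u} {w = w} indep odd u∈ w∈ =
    decidable-stable (u ≟ w) λ u≢w →
      let x , x∈ , u≢x , w≢x = odd-third odd u∈ w∈ u≢w
      in clawFree (inducedStar-independent indep
           ((u≢w ∷ u≢x ∷ []) ∷ (w≢x ∷ []) ∷ [] ∷ []) (u∈ ∷ w∈ ∷ x∈ ∷ []))

  oddIndependent⇒independent² : ClawFree G → ∀ S → OddIndependent G S → Independent (G ²) S
  oddIndependent⇒independent² clawFree S (indep , odd) u v u∈S v∈S
    (u≢v , _ , d≤2 , walk , _) = noWalk d≤2 walk
    where
    noWalk : l ≤ 2 → ¬ Walk l u v
    noWalk _ []        = u≢v refl
    noWalk _ (e ∷ [])  = indep _ _ u∈S v∈S e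
    -- The midpoint `w` is adjacent to `u` in `S`, hence lies outside `S`, and the odd condition
    -- applies to it. Since `w` sees both `u` and `v`, its intersection with `S` is nonempty, so
    -- odd, and the two ends must coincide.
    noWalk _ (_∷_ {w = w} u~w (w~v ∷ [])) =
      [ (λ empty → empty (u , u∈))
      , (λ odd-w → u≢v (odd-neighbours-unique clawFree indep odd-w u∈ v∈)) ]′
      (odd w λ w∈S → indep u w u∈S w∈S u~w)
      where
      u∈ : u ∈ N G w ∩ S
      u∈ = x∈p∩q⁺ (∈N⁺ (~-sym u~w) , u∈S)
      v∈ : v ∈ N G w ∩ S
      v∈ = x∈p∩q⁺ (∈N⁺ w~v , v∈S)
    noWalk (s≤s (s≤s ())) (_ ∷ _ ∷ _ ∷ _)

  -- Two distinct members of `S` in `N G v` would be joined by a walk of length 2 through `v`, so a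
  -- nonempty intersection is a singleton.
  independent²⇒oddIndependent : ∀ S → Independent (G ²) S → OddIndependent G S
  independent²⇒oddIndependent S indep² = indep , odd
    where
    indep : Independent G S
    indep u v u∈S v∈S u~v =
      indep² u v u∈S v∈S (walk⇒~² (λ u≡v → ~-irrefl u≡v u~v) (u~v ∷ []) (s≤s z≤n))
    odd : ∀ v → v ∉ S → _
    odd v _ with nonempty? (N G v ∩ S)
    ... | no empty = inj₁ empty
    ... | yes (u , u∈) = inj₂ (odd-singleton u∈ λ {w} w∈ → decidable-stable (w ≟ u) λ w≢u →
      let u∈N , u∈S = x∈p∩q⁻ (N G v) S u∈
          w∈N , w∈S = x∈p∩q⁻ (N G v) S w∈
      in indep² w u w∈S u∈S (walk⇒~² w≢u (~-sym (∈N⁻ w∈N) ∷ ∈N⁻ u∈N ∷ []) ≤-refl))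

  oddIndependent⇔independent² : ClawFree G → ∀ S → OddIndependent G S ⇔ Independent (G ²) S
  oddIndependent⇔independent² clawFree S =
    mk⇔ (oddIndependent⇒independent² clawFree S) (independent²⇒oddIndependent S)

∈class⁺ : (c : Coloring n k) {u : Fin n} {i : Fin k} → lookup c u ≡ i → u ∈ class c i
∈class⁺ c {i = i} = ∈-tabulate⁺ (λ u → lookup c u ≟ i)

∈class⁻ : (c : Coloring n k) {u : Fin n} {i : Fin k} → u ∈ class c i → lookup c u ≡ i
∈class⁻ c {i = i} = ∈-tabulate⁻ (λ u → lookup c u ≟ i)

proper⇔independent : (G : Graph n) (c : Coloring n k) → Proper G c ⇔ (∀ i → Independent G (class c i))
proper⇔independent G c = mk⇔
  (λ proper i u v u∈ v∈ u~v → proper u v u~v (trans (∈class⁻ c u∈) (sym (∈class⁻ c v∈))))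
  (λ indep u v u~v eq → indep (lookup c v) u v (∈class⁺ c eq) (∈class⁺ c refl) u~v)

-- The two parity conditions range over different vertices: `StrongOdd` constrains every `v`, while
-- `OddIndependent` constrains only those outside the class. They agree because a vertex has no
-- neighbour in its own class.
strongOdd⇔oddIndependent : (G : Graph n) (c : Coloring n k) →
                           StrongOdd G c ⇔ (∀ i → OddIndependent G (class c i))
strongOdd⇔oddIndependent G c = mk⇔ ⇒ ⇐
  where
  ⇒ : StrongOdd G c → ∀ i → OddIndependent G (class c i)
  ⇒ (proper , odd) i = to (proper⇔independent G c) proper i , odd-i
    where
    odd-i : ∀ v → v ∉ class c i → _
    odd-i v _ with nonempty? (N G v ∩ class c i)
    ... | no empty = inj₁ empty
    ... | yes (u , u∈) =
      let u∈N , u∈i = x∈p∩q⁻ (N G v) (class c i) u∈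
      in inj₂ (odd v i (u , u∈N , ∈class⁻ c u∈i))
  ⇐ : (∀ i → OddIndependent G (class c i)) → StrongOdd G c
  ⇐ oddIndep = from (proper⇔independent G c) (proj₁ ∘ oddIndep) , λ v i (u , u∈N , eq) →
    let indep , odd = oddIndep i
        u∈i = ∈class⁺ c eq
    in [ (λ empty → contradiction (u , x∈p∩q⁺ (u∈N , u∈i)) empty) , id ]′
       -- If `v` had colour `i` itself, its neighbour `u` of the same colour would violate
       -- independence.
       (odd v λ v∈i → indep v u v∈i u∈i (∈N⁻ G u∈N))

-- Both sides are conditions on each colour class separately, so the equivalence for sets transfers
-- class by class, keeping the colouring and its number of colours.
strongOdd⇔proper² : (G : Graph n) → ClawFree G → (c : Coloring n k) → StrongOdd G c ⇔ Proper (G ²) c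
strongOdd⇔proper² G clawFree c = mk⇔
  (λ so → from (proper⇔independent (G ²) c) λ i →
    to (oddIndependent⇔independent² G clawFree _) (to (strongOdd⇔oddIndependent G c) so i))
  (λ proper → from (strongOdd⇔oddIndependent G c) λ i →
    from (oddIndependent⇔independent² G clawFree _) (to (proper⇔independent (G ²) c) proper i))

theorem1 : (n : ℕ) (G : Graph n) → ClawFree G → (αod G ≡ α (G ²)) × (χso G ≡ χ (G ²))
theorem1 n G clawFree =
    IsGreatest-unique
      -- The same set witnesses both sides, so its size carries over unchanged.
      (λ _ → mk⇔ (λ (S , P , eq) → S , to (odd⇔² S) P , eq)
                 (λ (S , P , eq) → S , from (odd⇔² S) P , eq))
      (αod-isGreatest G) (α-isGreatest (G ²))
  , IsLeast-unique
      (λ _ → mk⇔ (λ (c , P) → c , to (strongOdd⇔proper² G clawFree c) P)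
                 (λ (c , P) → c , from (strongOdd⇔proper² G clawFree c) P))
      (χso-isLeast G) (χ-isLeast (G ²))
  where
  odd⇔² : ∀ S → OddIndependent G S ⇔ Independent (G ²) S
  odd⇔² = oddIndependent⇔independent² G clawFree
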